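{- For all integers $m\geq 0$ and $n\geq 1$, \[ q(m,n)\geq p(-m+1,n). \]
   Context: For a partition $\lambda$, $\operatorname{rank}(\lambda)$ is its largest part minus its number of parts. $p(m,n)$ is the number of partitions of $n$ with rank at least $m$. For a partition $\lambda=(\lambda_1\geq\cdots\geq\lambda_\ell)$, its rank-set is the infinite sequence $[-\lambda_1,1-\lambda_2,\ldots,j-\lambda_{j+1},\ldots,\ell-1-\lambda_\ell,\ell,\ell+1,\ldots]$. Then $q(m,n)$ is the number of partitions of $n$ whose rank-set contains $m$. -}

module Defs where

open import Data.Nat.Base using (ℕ; zero; suc; _≥_; _<_; z≤n; s≤s; z<s)
open import Data.Nat.Properties using (_≥?_; _<?_; anyUpTo?; suc-injective; ≮⇒≥)
open import Data.Nat.ListAction using (sum)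
open import Data.Integer.Base as ℤ using (ℤ; +_)
import Data.Integer.Properties as ℤ
open import Data.List.Base using (List; []; _∷_; length; filter; concatMap)
open import Data.List.Extrema.Nat using (max)
open import Data.List.Membership.Propositional using (_∈_; find; lose)
open import Data.List.Membership.Propositional.Properties using (∈-filter⁺; ∈-filter⁻; ∈-concatMap⁺; ∈-concatMap⁻)
open import Data.List.Relation.Binary.Disjoint.Propositional using (Disjoint)
open import Data.List.Relation.Unary.All as All using (All; []; _∷_)
import Data.List.Relation.Unary.All.Properties as All
open import Data.List.Relation.Unary.AllPairs using (AllPairs; []; _∷_)
import Data.List.Relation.Unary.AllPairs.Properties as AllPairs
open import Data.List.Relation.Unary.Any using (here; there)
open import Data.List.Relation.Unary.Linked using (Linked; linked?)
open import Data.List.Relation.Unary.Unique.Propositional using (Unique)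
import Data.List.Relation.Unary.Unique.Propositional.Properties as Unique
open import Data.Product.Base using (∃; _×_; _,_; proj₁)
open import Data.Sum.Base using (_⊎_; inj₁; inj₂)
open import Relation.Binary.PropositionalEquality using (_≡_; _≢_; refl; sym; trans; cong; subst)
open import Relation.Nullary.Decidable using (Dec; yes; no; map′; _⊎-dec_)

record IsPartition (n : ℕ) (xs : List ℕ) : Set where
  constructor isPartition
  field
    positive   : All (0 <_) xs
    decreasing : Linked _≥_ xs
    sum≡       : sum xs ≡ n

rank : List ℕ → ℤ
rank xs = + max 0 xs ℤ.- + length xs

-- part xs j is λ_{j+1} for λ = xs, with λ_{j+1} = 0 once j ≥ length xs.
part : List ℕ → ℕ → ℕ
part []       _       = 0
part (x ∷ _)  zero    = x
part (_ ∷ xs) (suc j) = part xs j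

rankSet : List ℕ → ℕ → ℤ
rankSet xs j = + j ℤ.- + part xs j

infix 4 _∈rankSet_

_∈rankSet_ : ℤ → List ℕ → Set
m ∈rankSet xs = ∃ λ j → rankSet xs j ≡ m

part-beyond : ∀ xs {j} → j ≥ length xs → part xs j ≡ 0
part-beyond []       _         = refl
part-beyond (_ ∷ xs) (s≤s j≥ℓ) = part-beyond xs j≥ℓ

rankSet-beyond : ∀ xs {j} → j ≥ length xs → rankSet xs j ≡ + j
rankSet-beyond xs {j} j≥ℓ =
  trans (cong (λ k → + j ℤ.- + k) (part-beyond xs j≥ℓ)) (ℤ.+-identityʳ (+ j))

_∈rankSet?_ : ∀ m xs → Dec (m ∈rankSet xs)
m ∈rankSet? xs =
  map′ to from (anyUpTo? (λ j → rankSet xs j ℤ.≟ m) ℓ ⊎-dec (+ ℓ ℤ.≤? m))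
  where
  ℓ = length xs

  to : (∃ λ j → j < ℓ × rankSet xs j ≡ m) ⊎ + ℓ ℤ.≤ m → m ∈rankSet xs
  to (inj₁ (j , _ , eq))  = j , eq
  to (inj₂ (ℤ.+≤+ ℓ≤k))   = _ , rankSet-beyond xs ℓ≤k

  from : m ∈rankSet xs → (∃ λ j → j < ℓ × rankSet xs j ≡ m) ⊎ + ℓ ℤ.≤ m
  from (j , eq) with j <? ℓ
  ... | yes j<ℓ = inj₁ (j , j<ℓ , eq)
  ... | no  j≮ℓ = inj₂ (subst (+ ℓ ℤ.≤_) (trans (sym (rankSet-beyond xs j≥ℓ)) eq) (ℤ.+≤+ j≥ℓ))
    where j≥ℓ = ≮⇒≥ j≮ℓ

-- Every composition of n + 1 arises from exactly one composition of n by
-- prepending a part 1 or by adding 1 to the first part.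
extend : List ℕ → List (List ℕ)
extend []       = (1 ∷ []) ∷ []
extend (x ∷ xs) = (1 ∷ x ∷ xs) ∷ (suc x ∷ xs) ∷ []

compositions : ℕ → List (List ℕ)
compositions zero    = [] ∷ []
compositions (suc n) = concatMap extend (compositions n)

-- By ∈-partitions⁻, ∈-partitions⁺ and partitions-unique below, this lists
-- each xs with IsPartition n xs exactly once.
partitions : ℕ → List (List ℕ)
partitions n = filter (linked? _≥?_) (compositions n)

p : ℤ → ℕ → ℕ
p m n = length (filter (λ xs → m ℤ.≤? rank xs) (partitions n))

q : ℤ → ℕ → ℕ
q m n = length (filter (m ∈rankSet?_) (partitions n))

extend-sound : ∀ {xs ys} → All (0 <_) xs → ys ∈ extend xs →
               All (0 <_) ys × sum ys ≡ suc (sum xs)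
extend-sound []         (here refl)         = z<s ∷ [] , refl
extend-sound (px ∷ pxs) (here refl)         = z<s ∷ px ∷ pxs , refl
extend-sound (px ∷ pxs) (there (here refl)) = z<s ∷ pxs , refl

∈-compositions⁻ : ∀ n {xs} → xs ∈ compositions n → All (0 <_) xs × sum xs ≡ n
∈-compositions⁻ zero    (here refl) = [] , refl
∈-compositions⁻ (suc n) xs∈ with find (∈-concatMap⁻ extend xs∈)
... | ys , ys∈ , xs∈ys with ∈-compositions⁻ n ys∈
...   | pos , eq with extend-sound pos xs∈ys
...     | pos′ , eq′ = pos′ , trans eq′ (cong suc eq)

∈-compositions⁺ : ∀ n {xs} → All (0 <_) xs → sum xs ≡ n → xs ∈ compositions n
∈-compositions⁺ zero    {[]}               _          _  = here refl
∈-compositions⁺ zero    {zero ∷ _}         (() ∷ _)   _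
∈-compositions⁺ zero    {suc _ ∷ _}        _          ()
∈-compositions⁺ (suc n) {1 ∷ []}           (_ ∷ pos)  eq =
  ∈-concatMap⁺ extend (lose (∈-compositions⁺ n pos (suc-injective eq)) (here refl))
∈-compositions⁺ (suc n) {1 ∷ _ ∷ _}        (_ ∷ pos)  eq =
  ∈-concatMap⁺ extend (lose (∈-compositions⁺ n pos (suc-injective eq)) (here refl))
∈-compositions⁺ (suc n) {suc (suc x) ∷ xs} (_ ∷ pos)  eq =
  ∈-concatMap⁺ extend
    (lose (∈-compositions⁺ n {suc x ∷ xs} (z<s ∷ pos) (suc-injective eq)) (there (here refl)))

retract : List ℕ → List ℕ
retract (suc (suc x) ∷ xs) = suc x ∷ xs
retract (_ ∷ xs)           = xs
retract []                 = []

retract-extend : ∀ {xs ys} → All (0 <_) xs → ys ∈ extend xs → retract ys ≡ xs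
retract-extend []            (here refl)         = refl
retract-extend (_ ∷ _)       (here refl)         = refl
retract-extend (s≤s z≤n ∷ _) (there (here refl)) = refl

extend-unique : ∀ {xs} → All (0 <_) xs → Unique (extend xs)
extend-unique []            = [] ∷ []
extend-unique (s≤s z≤n ∷ _) = ((λ ()) ∷ []) ∷ [] ∷ []

extend-disjoint : ∀ {xss} → All (All (0 <_)) xss → Unique xss →
                  AllPairs (λ xs ys → Disjoint (extend xs) (extend ys)) xss
extend-disjoint []                   []         = []
extend-disjoint {xs ∷ _} (px ∷ pxss) (x≢ ∷ uxs) = heads pxss x≢ ∷ extend-disjoint pxss uxs
  where
  heads : ∀ {yss} → All (All (0 <_)) yss → All (xs ≢_) yss →
          All (λ ys → Disjoint (extend xs) (extend ys)) yss
  heads []         []           = []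
  heads (py ∷ pys) (x≢y ∷ x≢ys) =
    (λ (z∈x , z∈y) → x≢y (trans (sym (retract-extend px z∈x)) (retract-extend py z∈y)))
    ∷ heads pys x≢ys

compositions-unique : ∀ n → Unique (compositions n)
compositions-unique zero    = [] ∷ []
compositions-unique (suc n) =
  Unique.concat⁺ (All.map⁺ (All.map extend-unique pos))
                 (AllPairs.map⁺ (extend-disjoint pos (compositions-unique n)))
  where
  pos : All (All (0 <_)) (compositions n)
  pos = All.tabulate λ xs∈ → proj₁ (∈-compositions⁻ n xs∈)

∈-partitions⁻ : ∀ n {xs} → xs ∈ partitions n → IsPartition n xs
∈-partitions⁻ n xs∈ with ∈-filter⁻ (linked? _≥?_) xs∈
... | xs∈c , dec with ∈-compositions⁻ n xs∈c
...   | pos , eq = isPartition pos dec eq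

∈-partitions⁺ : ∀ n {xs} → IsPartition n xs → xs ∈ partitions n
∈-partitions⁺ n (isPartition pos dec eq) =
  ∈-filter⁺ (linked? _≥?_) (∈-compositions⁺ n pos eq) dec

partitions-unique : ∀ n → Unique (partitions n)
partitions-unique n = Unique.filter⁺ (linked? _≥?_) (compositions-unique n)

{-# OPTIONS --safe #-}

-- Suppose m is not in the rank-set of λ, and let (m + j) × j be the largest
-- rectangle of that shape contained in λ.  Then all parts below the rectangle
-- are smaller than j; call them β.  If moreover rank λ ≥ 1 − m, then
-- λ₁ − j > ℓ(β).  Remove the first row of λ, insert a row i just above β, and
-- add 1 to each of the first λ₁ − i rows below it (β being padded with zeros),
-- where i = j if β₁ = j − 1 and i = j − 1 otherwise.  The result μ is a
-- partition of the same size with μ_{m+i+1} = i, so its rank-set contains m,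
-- and its rank is at most −m.  From μ one reads off i, and whether the inserted
-- row is number m + i (when μ_{m+i} = i) or m + i + 1 (when μ_{m+i} > i), hence
-- λ.  So this map, together with the identity on the partitions of rank ≥ 1 − m
-- whose rank-set contains m, is injective.
module Submission where

open import Defs
open import Data.Nat.Base using (ℕ; _≥_; zero; suc; pred; _+_; _∸_; _≤_; _<_; z≤n; s≤s; z<s; s≤s⁻¹)
open import Data.Nat.Properties
open import Data.Nat.ListAction using (sum)
open import Data.Nat.ListAction.Properties using (sum-++)
import Data.Nat.Tactic.RingSolver as ℕ-Solver
open import Data.Integer.Base using (ℤ; 0ℤ; 1ℤ; -_) renaming (_+_ to _+ℤ_; _≥_ to _≥ℤ_)
open import Data.Integer.Base using (+_; _-_) renaming (_≤_ to _≤ℤ_)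
import Data.Integer.Properties as ℤ
import Data.Integer.Tactic.RingSolver as ℤ-Solver
open import Data.List.Base using (List; []; _∷_; _++_; length; map; filter; take; drop)
open import Data.List.Properties using (length-map; length-++; length-take; take++drop≡id)
open import Data.List.Extrema ≤-totalOrder using (max; max≤v⁺)
open import Data.List.Membership.Propositional.Properties using (∈-filter⁺; ∈-filter⁻; ∈-map⁺; ∈-∃++; ∈-++⁺ˡ; ∈-++⁺ʳ; ∈-++⁻)
open import Data.List.Relation.Binary.Subset.Propositional using (_⊆_)
open import Data.List.Relation.Unary.All as All using (All; []; _∷_)
import Data.List.Relation.Unary.All.Properties as All
open import Data.List.Relation.Unary.AllPairs using (AllPairs; []; _∷_)
import Data.List.Relation.Unary.AllPairs.Properties as AllPairs
open import Data.List.Relation.Unary.Any using (here; there)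
open import Data.List.Relation.Unary.Linked.Properties using (AllPairs⇒Linked; Linked⇒AllPairs)
open import Data.List.Relation.Unary.Unique.Propositional using (Unique)
import Data.List.Relation.Unary.Unique.Propositional.Properties as Unique
open import Data.Product.Base using (∃; _×_; _,_)
open import Data.Sum.Base using (inj₁; inj₂)
open import Function.Base using (_∘_; flip)
open import Relation.Binary.Definitions using (tri<; tri≈; tri>)
open import Relation.Binary.PropositionalEquality
open import Relation.Nullary using (¬_; yes; no; contradiction)

-- Pigeonhole for lists and a discrete crossing point

Unique∧⊆⇒length≤ : ∀ {a} {A : Set a} {xs ys : List A} → Unique xs → xs ⊆ ys → length xs ≤ length ys
Unique∧⊆⇒length≤ []                  _     = z≤n
Unique∧⊆⇒length≤ {xs = x ∷ xs} (x∉xs ∷ uniq) xs⊆ys with ∈-∃++ (xs⊆ys (here refl))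
... | us , vs , refl = begin
  suc (length xs)              ≤⟨ s≤s (Unique∧⊆⇒length≤ uniq xs⊆us++vs) ⟩
  suc (length (us ++ vs))      ≡⟨ cong suc (length-++ us) ⟩
  suc (length us + length vs)  ≡⟨ +-suc (length us) (length vs) ⟨
  length us + length (x ∷ vs)  ≡⟨ length-++ us ⟨
  length (us ++ x ∷ vs)        ∎
  where
  open ≤-Reasoning
  xs⊆us++vs : xs ⊆ us ++ vs
  xs⊆us++vs z∈xs with ∈-++⁻ us (xs⊆ys (there z∈xs))
  ... | inj₁ z∈us         = ∈-++⁺ˡ z∈us
  ... | inj₂ (here refl)  = contradiction refl (All.lookup x∉xs z∈xs)
  ... | inj₂ (there z∈vs) = ∈-++⁺ʳ us z∈vs

-- Descending from `N`, the values of `f` stay below the diagonal until they first jump above it,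
-- since they never land on it. The descent stops because `f 0 < 0` is absurd.
crossing : (f : ℕ → ℕ) → (∀ i → f i ≢ i) → ∀ N → f N < N → ∃ λ j → j < f j × f (suc j) < suc j
crossing f f≢ (suc N) fN<N with <-cmp (f N) N
... | tri< lt _ _ = crossing f f≢ N lt
... | tri≈ _ eq _ = contradiction eq (f≢ N)
... | tri> _ _ gt = N , gt , fN<N

-- Parts of concatenations and of decreasing lists

part-++ : ∀ xs {ys} h → part (xs ++ ys) (length xs + h) ≡ part ys h
part-++ []       h = refl
part-++ (_ ∷ xs) h = part-++ xs h

part-++-length : ∀ xs {y ys} → part (xs ++ y ∷ ys) (length xs) ≡ y
part-++-length []       = refl
part-++-length (_ ∷ xs) = part-++-length xs

part-All : ∀ {P : ℕ → Set} {xs} → P 0 → All P xs → ∀ j → P (part xs j)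
part-All p0 []         _       = p0
part-All p0 (px ∷ _)   zero    = px
part-All p0 (_ ∷ pxs)  (suc j) = part-All p0 pxs j

part-antitone : ∀ {xs} → AllPairs _≥_ xs → ∀ {j k} → j ≤ k → part xs k ≤ part xs j
part-antitone []         _                 = z≤n
part-antitone (_ ∷ _)    {zero}  {zero}  _ = ≤-refl
part-antitone (≥xs ∷ _)  {zero}  {suc k} _ = part-All z≤n ≥xs k
part-antitone (_ ∷ dec)  {suc _} {suc _} (s≤s j≤k) = part-antitone dec j≤k

part>0⇒<length : ∀ xs {j} → 0 < part xs j → j < length xs
part>0⇒<length xs {j} 0<part with <-≤-connex j (length xs)
... | inj₁ j<ℓ = j<ℓ
... | inj₂ ℓ≤j = contradiction 0<part (<-irrefl (sym (part-beyond xs ℓ≤j)))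

take-≥part : ∀ {xs} → AllPairs _≥_ xs → ∀ h → All (part xs h ≤_) (take (suc h) xs)
take-≥part []          _       = []
take-≥part (_ ∷ _)     zero    = ≤-refl ∷ []
take-≥part (≥xs ∷ dec) (suc h) = part-All z≤n ≥xs h ∷ take-≥part dec h

drop-≤part : ∀ {xs} → AllPairs _≥_ xs → ∀ h → All (_≤ part xs h) (drop h xs)
drop-≤part []          zero    = []
drop-≤part []          (suc h) = []
drop-≤part (≥xs ∷ _)   zero    = ≤-refl ∷ ≥xs
drop-≤part (_ ∷ dec)   (suc h) = drop-≤part dec h

take-length-++ : ∀ (xs : List ℕ) {ys} → take (length xs) (xs ++ ys) ≡ xs
take-length-++ []       = refl
take-length-++ (x ∷ xs) = cong (x ∷_) (take-length-++ xs)

drop-suc-length-++ : ∀ (xs : List ℕ) {y ys} → drop (suc (length xs)) (xs ++ y ∷ ys) ≡ ys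
drop-suc-length-++ []       = refl
drop-suc-length-++ (_ ∷ xs) = drop-suc-length-++ xs

AllPairs-++⁻ʳ : ∀ xs {ys} → AllPairs _≥_ (xs ++ ys) → AllPairs _≥_ ys
AllPairs-++⁻ʳ []       dec       = dec
AllPairs-++⁻ʳ (_ ∷ xs) (_ ∷ dec) = AllPairs-++⁻ʳ xs dec

-- Rank-set and rank conditions in natural numbers

rankSet≡⇒ : ∀ xs k {m} → rankSet xs k ≡ + m → k ≡ m + part xs k
rankSet≡⇒ xs k eq = ℤ.+-injective (trans (lemma (+ k) (+ part xs k)) (cong (_+ℤ + part xs k) eq))
  where
  lemma : ∀ i j → i ≡ (i - j) +ℤ j
  lemma = ℤ-Solver.solve-∀

rankSet≡⇐ : ∀ xs {k m} → k ≡ m + part xs k → rankSet xs k ≡ + m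
rankSet≡⇐ xs {k} {m} eq = trans (cong (λ z → + z - + part xs k) eq) (lemma (+ m) (+ part xs k))
  where
  lemma : ∀ i j → (i +ℤ j) - j ≡ i
  lemma = ℤ-Solver.solve-∀

-- As the index grows the parts do not, so the rank-set of a partition is strictly increasing and
-- meets `m` at most once.
rankSet-injective : ∀ {xs} → AllPairs _≥_ xs → ∀ {m k k′} →
                    k ≡ m + part xs k → k′ ≡ m + part xs k′ → k ≡ k′
rankSet-injective {xs} dec {m} eq eq′ = ≤-antisym (≮⇒≥ (≮ eq′ eq)) (≮⇒≥ (≮ eq eq′))
  where
  ≮ : ∀ {k k′} → k ≡ m + part xs k → k′ ≡ m + part xs k′ → ¬ (k < k′)
  ≮ eq eq′ k<k′ = <⇒≱ k<k′
    (subst₂ _≤_ (sym eq′) (sym eq) (+-monoʳ-≤ m (part-antitone dec (<⇒≤ k<k′))))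

-- Adding `m + length xs` to both sides clears the subtractions; the largest part may then be
-- replaced by any bound `v` on the parts.
1-m≤rank⇒ : ∀ {m v} xs → All (_≤ v) xs → - (+ m) +ℤ 1ℤ ≤ℤ rank xs → length xs < v + m
1-m≤rank⇒ {m} {v} xs xs≤v le = ≤-trans
  (ℤ.drop‿+≤+ (subst₂ _≤ℤ_ (lhs (+ m) (+ length xs)) (rhs (+ max 0 xs) (+ m) (+ length xs))
    (ℤ.+-monoˡ-≤ (+ m +ℤ + length xs) le)))
  (+-monoˡ-≤ m (max≤v⁺ z≤n xs≤v))
  where
  lhs : ∀ i l → (- i +ℤ 1ℤ) +ℤ (i +ℤ l) ≡ 1ℤ +ℤ l
  lhs = ℤ-Solver.solve-∀
  rhs : ∀ a i l → (a - l) +ℤ (i +ℤ l) ≡ a +ℤ i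
  rhs = ℤ-Solver.solve-∀

-- Adding 1 to the first `b` rows, and undoing it

raise : ℕ → List ℕ → List ℕ
raise zero    _        = []
raise (suc b) []       = 1 ∷ raise b []
raise (suc b) (x ∷ xs) = suc x ∷ raise b xs

-- Left inverse of raise b on decreasing lists of positive parts: everything
-- after the first 1 is padding.
lower : List ℕ → List ℕ
lower (suc (suc x) ∷ xs) = suc x ∷ lower xs
lower _                  = []

lower-raise : ∀ {b xs} → All (0 <_) xs → length xs ≤ b → lower (raise b xs) ≡ xs
lower-raise {zero}  []              _         = refl
lower-raise {suc b} []              _         = refl
lower-raise {suc b} (s≤s z≤n ∷ pos) (s≤s ℓ≤b) = cong (_ ∷_) (lower-raise pos ℓ≤b)

length-raise : ∀ b xs → length (raise b xs) ≡ b
length-raise zero    _        = refl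
length-raise (suc b) []       = cong suc (length-raise b [])
length-raise (suc b) (_ ∷ xs) = cong suc (length-raise b xs)

sum-raise : ∀ {b} xs → length xs ≤ b → sum (raise b xs) ≡ b + sum xs
sum-raise {zero}  []       _         = refl
sum-raise {suc b} []       _         = cong suc (sum-raise {b} [] z≤n)
sum-raise {suc b} (x ∷ xs) (s≤s ℓ≤b) =
  cong suc (trans (cong (_+_ x) (sum-raise xs ℓ≤b)) (lemma x b (sum xs)))
  where
  lemma : ∀ x b s → x + (b + s) ≡ b + (x + s)
  lemma = ℕ-Solver.solve-∀

part-raise : ∀ {b} xs → 0 < b → part (raise b xs) 0 ≡ suc (part xs 0)
part-raise {suc b} []      _ = refl
part-raise {suc b} (_ ∷ _) _ = refl

raise-≤ : ∀ {i} b {xs} → 0 < i → All (_< i) xs → All (_≤ i) (raise b xs)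
raise-≤ zero    0<i _          = []
raise-≤ (suc b) 0<i []         = 0<i ∷ raise-≤ b 0<i []
raise-≤ (suc b) 0<i (lt ∷ lts) = lt ∷ raise-≤ b 0<i lts

raise-positive : ∀ b xs → All (0 <_) (raise b xs)
raise-positive zero    _        = []
raise-positive (suc b) []       = z<s ∷ raise-positive b []
raise-positive (suc b) (_ ∷ xs) = z<s ∷ raise-positive b xs

raise-decreasing : ∀ b {xs} → AllPairs _≥_ xs → AllPairs _≥_ (raise b xs)
raise-decreasing zero    _           = []
raise-decreasing (suc b) []          = raise-≤ b z<s [] ∷ raise-decreasing b []
raise-decreasing (suc b) (≥xs ∷ dec) = raise-≤ b z<s (All.map s≤s ≥xs) ∷ raise-decreasing b dec

-- The shifted partition μ

module _ {i b : ℕ} (ts : List ℕ) {β : List ℕ} {n : ℕ}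
         (isP : IsPartition n (i + b ∷ ts ++ β))
         (0<i : 0 < i) (i≤ts : All (i ≤_) ts) (β<i : All (_< i) β) (ℓβ≤b : length β ≤ b) where

  private
    open IsPartition isP

    pairs : AllPairs _≥_ (i + b ∷ ts ++ β)
    pairs = Linked⇒AllPairs (flip ≤-trans) decreasing

    top≥ : All (_≤ i + b) (ts ++ β)
    top≥ with ≥xs ∷ _ ← pairs = ≥xs

    tail-pairs : AllPairs _≥_ (ts ++ β)
    tail-pairs with _ ∷ dec ← pairs = dec

    tail-positive : All (0 <_) (ts ++ β)
    tail-positive with _ ∷ pos ← positive = pos

    ts-pairs : AllPairs _≥_ ts
    ts-pairs = subst (AllPairs _≥_) (take-length-++ ts) (AllPairs.take⁺ (length ts) tail-pairs)

    β-pairs : AllPairs _≥_ β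
    β-pairs = AllPairs-++⁻ʳ ts tail-pairs

  -- The removed first row is written `i + b`: `i` of its cells form the inserted row, and the other
  -- `b` go one to each of the first `b` rows below it.
  shifted : List ℕ
  shifted = ts ++ i ∷ raise b β

  -- Parts of `β` are smaller than `i`, so raising them by 1 keeps them at most `i`; the padding
  -- rows become 1, which is at most `i` as `0 < i`.
  shifted-pairs : AllPairs _≥_ shifted
  shifted-pairs = AllPairs.++⁺ ts-pairs (raise-≤ b 0<i β<i ∷ raise-decreasing b β-pairs)
    (All.map (λ i≤t → i≤t ∷ All.map (λ r≤i → ≤-trans r≤i i≤t) (raise-≤ b 0<i β<i)) i≤ts)

  shifted-isPartition : IsPartition n shifted
  shifted-isPartition = isPartition
    (All.++⁺ (All.++⁻ˡ ts tail-positive) (0<i ∷ raise-positive b β))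
    (AllPairs⇒Linked shifted-pairs)
    (begin
      sum (ts ++ i ∷ raise b β)      ≡⟨ sum-++ ts _ ⟩
      sum ts + (i + sum (raise b β)) ≡⟨ cong (λ s → sum ts + (i + s)) (sum-raise β ℓβ≤b) ⟩
      sum ts + (i + (b + sum β))     ≡⟨ lemma (sum ts) i b (sum β) ⟩
      i + b + (sum ts + sum β)       ≡⟨ cong (_+_ (i + b)) (sum-++ ts β) ⟨
      i + b + sum (ts ++ β)          ≡⟨ sum≡ ⟩
      n                              ∎)
    where
    open ≡-Reasoning
    lemma : ∀ t i b s → t + (i + (b + s)) ≡ i + b + (t + s)
    lemma = ℕ-Solver.solve-∀

  -- All parts are at most `i + b`, while their number `length ts + 1 + b` is at least `m + i + b`.
  -- Hence the rank is at most - m, which separates μ from the partitions that `restore` fixes.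
  shifted-rank : ∀ {m} → m + i ≤ suc (length ts) → ¬ (- (+ m) +ℤ 1ℤ ≤ℤ rank shifted)
  shifted-rank {m} m+i≤ le = <-irrefl refl (begin-strict
    length shifted           <⟨ 1-m≤rank⇒ shifted shifted≤ le ⟩
    i + b + m                ≡⟨ lemma i b m ⟩
    m + i + b                ≤⟨ +-monoˡ-≤ b m+i≤ ⟩
    suc (length ts) + b      ≡⟨ +-suc (length ts) b ⟨
    length ts + suc b        ≡⟨ cong (λ z → length ts + suc z) (length-raise b β) ⟨
    length ts + suc (length (raise b β)) ≡⟨ length-++ ts ⟨
    length shifted           ∎)
    where
    open ≤-Reasoning
    lemma : ∀ i b m → i + b + m ≡ m + i + b
    lemma = ℕ-Solver.solve-∀
    shifted≤ : All (_≤ i + b) shifted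
    shifted≤ = All.++⁺ (All.++⁻ˡ ts top≥)
      (m≤m+n i b ∷ All.map (λ r≤i → ≤-trans r≤i (m≤m+n i b)) (raise-≤ b 0<i β<i))

-- Recovering λ from μ

unshift : ℕ → List ℕ → List ℕ
-- Row `h` is the inserted row `i`, and exactly `b` rows lie below it.
unshift h ys = part ys h + length (drop (suc h) ys) ∷ take h ys ++ lower (drop (suc h) ys)

unshift-shifted : ∀ {i b} ts {β} → All (0 <_) β → length β ≤ b →
                  unshift (length ts) (ts ++ i ∷ raise b β) ≡ i + b ∷ ts ++ β
unshift-shifted {i} {b} ts {β} pos ℓβ≤b
  rewrite part-++-length ts {i} {raise b β} | drop-suc-length-++ ts {i} {raise b β}
        | take-length-++ ts {i ∷ raise b β} | length-raise b β | lower-raise pos ℓβ≤b = refl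

-- Here `k` is the index, counted from 0, at which the rank-set meets `m`. Row `k` is the inserted
-- row, unless β₁ = i - 1 was raised to `i`; then row `k` is that raised part and the inserted row
-- is just above it.
insertedRow : ℕ → List ℕ → ℕ
insertedRow k ys with part ys (pred k) ≟ part ys k
... | yes _ = pred k
... | no  _ = k

insertedRow-≡ : ∀ {k ys} → part ys (pred k) ≡ part ys k → insertedRow k ys ≡ pred k
insertedRow-≡ {k} {ys} eq with part ys (pred k) ≟ part ys k
... | yes _ = refl
... | no ≢  = contradiction eq ≢

insertedRow-≢ : ∀ {k ys} → part ys (pred k) ≢ part ys k → insertedRow k ys ≡ k
insertedRow-≢ {k} {ys} ≢ with part ys (pred k) ≟ part ys k
... | yes eq = contradiction eq ≢
... | no _   = refl

-- A left inverse of the map λ ↦ μ, and the identity on ranks at least 1 - m. Instead of injectivity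
-- of the map, it is shown that `restore` reaches every partition counted by `p`.
restore : ℕ → List ℕ → List ℕ
restore m ys with - (+ m) +ℤ 1ℤ ℤ.≤? rank ys | (+ m) ∈rankSet? ys
... | yes _ | _           = ys
... | no _  | yes (k , _) = unshift (insertedRow k ys) ys
... | no _  | no _        = []

restore-fixed : ∀ {m ys} → - (+ m) +ℤ 1ℤ ≤ℤ rank ys → restore m ys ≡ ys
restore-fixed {m} {ys} le with - (+ m) +ℤ 1ℤ ℤ.≤? rank ys | (+ m) ∈rankSet? ys
... | yes _  | _ = refl
... | no nle | _ = contradiction le nle

restore-unshift : ∀ {m ys k} → AllPairs _≥_ ys → ¬ (- (+ m) +ℤ 1ℤ ≤ℤ rank ys) →
                  k ≡ m + part ys k → restore m ys ≡ unshift (insertedRow k ys) ys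
restore-unshift {m} {ys} {k} dec nle eq with - (+ m) +ℤ 1ℤ ℤ.≤? rank ys | (+ m) ∈rankSet? ys
... | yes le | _            = contradiction le nle
-- The decision procedure supplies its own index `k′`, which uniqueness identifies with `k`.
... | no _   | yes (k′ , e) = cong (λ h → unshift (insertedRow h ys) ys)
                                (rankSet-injective dec (rankSet≡⇒ ys k′ e) eq)
... | no _   | no ∉         = contradiction (k , rankSet≡⇐ ys eq) ∉

-- Surjectivity of `restore`

Preimage : ℕ → ℕ → List ℕ → Set
Preimage m n xs = ∃ λ ys → IsPartition n ys × + m ∈rankSet ys × restore m ys ≡ xs

shifted-preimage : ∀ {m n i b} ts {β} → IsPartition n (i + b ∷ ts ++ β) →
                   0 < i → All (i ≤_) ts → All (_< i) β → length β ≤ b → m + i ≤ suc (length ts) →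
                   (k : ℕ) → let ys = ts ++ i ∷ raise b β in
                   k ≡ m + part ys k → insertedRow k ys ≡ length ts →
                   Preimage m n (i + b ∷ ts ++ β)
shifted-preimage {m} {i = i} {b} ts {β} isP 0<i i≤ts β<i ℓβ≤b m+i≤ k k≡ row≡ =
  ys ,
  shifted-isPartition ts isP 0<i i≤ts β<i ℓβ≤b ,
  (k , rankSet≡⇐ ys k≡) ,
  trans (restore-unshift (shifted-pairs ts isP 0<i i≤ts β<i ℓβ≤b)
                         (shifted-rank ts isP 0<i i≤ts β<i ℓβ≤b m+i≤) k≡)
    (trans (cong (λ h → unshift h ys) row≡) (unshift-shifted ts β-positive ℓβ≤b))
  where
  ys = ts ++ i ∷ raise b β
  β-positive : All (0 <_) β
  β-positive = All.++⁻ʳ ts (All.tail (IsPartition.positive isP))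

-- The rectangle has m + suc j rows and suc j columns; its first row is t.
preimage-rectangle : ∀ {m n j t} ts {β} → IsPartition n (t ∷ ts ++ β) →
                     length ts ≡ m + j → All (suc j ≤_) ts → All (_≤ j) β →
                     suc j + length β < t → Preimage m n (t ∷ ts ++ β)
preimage-rectangle {m} {n} {j} {t} ts {β} isP ℓts j<ts β≤j t> with part β 0 ≟ j
-- The inserted row `suc j` has index `m + j`; the raised β₁ below it is also `suc j`, at index
-- `m + suc j`, where the rank-set meets `m`.
... | yes β₁≡j = subst (λ z → Preimage m n (z ∷ ts ++ β)) i+b≡t
  (shifted-preimage {i = suc j} {b} ts (subst (λ z → IsPartition n (z ∷ ts ++ β)) (sym i+b≡t) isP)
    z<s j<ts (All.map s≤s β≤j) (<⇒≤ ℓβ<b) (≤-reflexive (trans (+-suc m j) (cong suc (sym ℓts))))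
    (suc (length ts)) k≡ (insertedRow-≡ {suc (length ts)} {ys} (trans (part-++-length ts) (sym part≡))))
  where
  b = t ∸ suc j
  i+b≡t : suc j + b ≡ t
  i+b≡t = m+[n∸m]≡n (≤-trans (m≤m+n (suc j) (length β)) (<⇒≤ t>))
  ℓβ<b : length β < b
  ℓβ<b = +-cancelˡ-< (suc j) _ _ (subst (_ <_) (sym i+b≡t) t>)
  ys = ts ++ suc j ∷ raise b β
  part≡ : part ys (suc (length ts)) ≡ suc j
  part≡ = trans (cong (part ys) (sym (+-comm (length ts) 1)))
            (trans (part-++ ts 1) (trans (part-raise β (≤-<-trans z≤n ℓβ<b)) (cong suc β₁≡j)))
  k≡ : suc (length ts) ≡ m + part ys (suc (length ts))
  k≡ = trans (cong suc ℓts) (trans (sym (+-suc m j)) (cong (_+_ m) (sym part≡)))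
-- Now β₁ < j, so `j` can be inserted; its index `m + j` already gives `m`, and the row above it is
-- longer.
... | no β₁≢j = subst (λ z → Preimage m n (z ∷ ts ++ β)) i+b≡t
  (shifted-preimage {i = j} {b} ts (subst (λ z → IsPartition n (z ∷ ts ++ β)) (sym i+b≡t) isP)
    0<j (All.map <⇒≤ j<ts) β<j ℓβ≤b (≤-trans (≤-reflexive (sym ℓts)) (n≤1+n _))
    (length ts) k≡ (insertedRow-≢ {length ts} {ys} (λ eq → <-irrefl (sym (trans eq part≡)) (above ts ℓts>0 j<ts))))
  where
  b = t ∸ j
  i+b≡t : j + b ≡ t
  i+b≡t = m+[n∸m]≡n (≤-trans (n≤1+n j) (≤-trans (m≤m+n (suc j) (length β)) (<⇒≤ t>)))
  ℓβ≤b : length β ≤ b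
  ℓβ≤b = +-cancelˡ-≤ j _ _ (subst (_ ≤_) (sym i+b≡t) (≤-trans (n≤1+n _) (<⇒≤ t>)))
  β₁<j : part β 0 < j
  β₁<j = ≤∧≢⇒< (part-All z≤n β≤j 0) β₁≢j
  0<j : 0 < j
  0<j = ≤-<-trans z≤n β₁<j
  β-pairs : AllPairs _≥_ β
  β-pairs = AllPairs-++⁻ʳ (t ∷ ts) (Linked⇒AllPairs (flip ≤-trans) (IsPartition.decreasing isP))
  β<j : All (_< j) β
  β<j = All.map (λ x≤β₁ → ≤-<-trans x≤β₁ β₁<j) (drop-≤part β-pairs 0)
  ys = ts ++ j ∷ raise b β
  -- Since `pred 0` is 0, a row above the inserted one must exist for the comparison in
  -- `insertedRow` to fail.
  ℓts>0 : 0 < length ts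
  ℓts>0 = subst (0 <_) (sym ℓts) (≤-trans 0<j (m≤n+m j m))
  part≡ : part ys (length ts) ≡ j
  part≡ = part-++-length ts
  k≡ : length ts ≡ m + part ys (length ts)
  k≡ = trans ℓts (cong (_+_ m) (sym part≡))
  above : ∀ us {vs} → 0 < length us → All (suc j ≤_) us → j < part (us ++ vs) (pred (length us))
  above (u ∷ [])      _ (j<u ∷ _)  = j<u
  above (u ∷ u′ ∷ us) _ (_ ∷ j<us) = above (u′ ∷ us) z<s j<us

-- If `m` is missed, `part xs (m + i)` never equals `i`, and a crossing at `j` gives the rectangle
-- with `m + suc j` rows and `suc j` columns.
preimage : ∀ {m n xs} → IsPartition n xs → - (+ m) +ℤ 1ℤ ≤ℤ rank xs → Preimage m n xs
preimage {m} {n} {xs} isP le with (+ m) ∈rankSet? xs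
... | yes m∈ = xs , isP , m∈ , restore-fixed le
... | no  m∉ = go xs isP le (crossing (λ i → part xs (m + i))
      (λ i eq → m∉ (m + i , rankSet≡⇐ xs (cong (_+_ m) (sym eq))))
      -- Beyond the last part the value is 0, and `suc` keeps the bound positive even for empty
      -- `xs`.
      (suc (length xs))
      (≤-<-trans (≤-reflexive (part-beyond xs (≤-trans (n≤1+n _) (m≤n+m _ m)))) z<s))
  where
  go : ∀ xs → IsPartition n xs → - (+ m) +ℤ 1ℤ ≤ℤ rank xs →
       (∃ λ j → j < part xs (m + j) × part xs (m + suc j) < suc j) → Preimage m n xs
  go []       _   _  (_ , () , _)
  go (t ∷ xs) isP le (j , j<part , part<) =
    subst (Preimage m n ∘ (t ∷_)) split
      (preimage-rectangle ts (subst (IsPartition n ∘ (t ∷_)) (sym split) isP) ℓts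
        -- Indices in `t ∷ xs` count the row `t`: index `m + j` is the last row of the rectangle,
        -- and `β` starts at the next one.
        (All.map (≤-trans j<part) (All.tail (take-≥part dec (m + j))))
        (All.map (λ x≤ → ≤-trans x≤ part≤j) (drop-≤part dec (suc (m + j))))
        t>)
    where
    ts = take (m + j) xs
    β  = drop (m + j) xs
    split : ts ++ β ≡ xs
    split = take++drop≡id (m + j) xs
    dec : AllPairs _≥_ (t ∷ xs)
    dec = Linked⇒AllPairs (flip ≤-trans) (IsPartition.decreasing isP)
    part≤j : part (t ∷ xs) (suc (m + j)) ≤ j
    part≤j = subst (λ k → part (t ∷ xs) k ≤ j) (+-suc m j) (s≤s⁻¹ part<)
    ℓts : length ts ≡ m + j
    ℓts = trans (length-take (m + j) xs)
            (m≤n⇒m⊓n≡m (s≤s⁻¹ (part>0⇒<length (t ∷ xs) (≤-<-trans z≤n j<part))))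
    t> : suc j + length β < t
    t> = +-cancelˡ-< m _ _ (begin-strict
      m + suc (j + length β)     ≡⟨ +-suc m _ ⟩
      suc (m + (j + length β))   ≡⟨ cong suc (+-assoc m j (length β)) ⟨
      suc (m + j + length β)     ≡⟨ cong (λ z → suc (z + length β)) ℓts ⟨
      suc (length ts + length β) ≡⟨ cong suc (length-++ ts) ⟨
      suc (length (ts ++ β))     ≡⟨ cong (suc ∘ length) split ⟩
      length (t ∷ xs)            <⟨ 1-m≤rank⇒ (t ∷ xs) (drop-≤part dec 0) le ⟩
      t + m                      ≡⟨ +-comm t m ⟩
      m + t                      ∎)
      where open ≤-Reasoning

-- Comparison of the two counts

theorem2p2 : (m : ℤ) (n : ℕ) → m ≥ℤ 0ℤ → n ≥ 1 → q m n ≥ p (- m +ℤ 1ℤ) n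
theorem2p2 (+ m) n _ _ = subst (p (- (+ m) +ℤ 1ℤ) n ≤_) (length-map (restore m) (filter ((+ m) ∈rankSet?_) (partitions n)))
  -- The partitions counted by `p` are distinct and all occur among the `q (+ m) n` restored lists.
  (Unique∧⊆⇒length≤ (Unique.filter⁺ _ (partitions-unique n)) ⊆restored)
  where
  ⊆restored : filter (λ xs → - (+ m) +ℤ 1ℤ ℤ.≤? rank xs) (partitions n) ⊆
              map (restore m) (filter ((+ m) ∈rankSet?_) (partitions n))
  ⊆restored xs∈
    with xs∈n , le ← ∈-filter⁻ (λ xs → - (+ m) +ℤ 1ℤ ℤ.≤? rank xs) xs∈
    with ys , isP , m∈ , refl ← preimage {m} (∈-partitions⁻ n xs∈n) le
    = ∈-map⁺ (restore m) (∈-filter⁺ ((+ m) ∈rankSet?_) (∈-partitions⁺ n isP) m∈)
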